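{- Let $D$ be a finite simple digraph with $UG(D)=K_{1,t}$ for some $t\ge 1$. Then $$F(D)=\begin{cases} t, & \text{if } D \text{ is oriented, or if at least one leaf has in-degree } 0,\\ t-1, & \text{otherwise.}\end{cases}$$
   Context: A finite simple digraph $D=(V,A)$ has finite nonempty vertex set $V$ and arc set $A$ consisting of ordered pairs of distinct vertices (no loops, no parallel arcs; both $(u,v)$ and $(v,u)$ may be present). $N_D^+(v)=\{u:(v,u)\in A\}$, $N_D^-(v)=\{u:(u,v)\in A\}$; the in-degree of $v$ is $|N_D^-(v)|$. $UG(D)$ is the underlying simple undirected graph, obtained by replacing every arc $(u,v)$ by the edge $\{u,v\}$. $K_{1,t}$ is the star with one vertex adjacent to $t$ other vertices and no other edges. $D$ is oriented if $(u,v)\in A$ implies $(v,u)\notin A$. A leaf is a vertex $v$ with $|N_D^+(v)\cup N_D^-(v)|=1$. Zero forcing: for $S\subseteq V$ let $B^0(S)=S$ and $B^{i+1}(S)=B^i(S)\cup\{w:\{w\}=N_D^+(v)\setminus B^i(S)\text{ for some }v\in B^i(S)\}$. $S$ is a zero forcing set (ZFS) if $B^t(S)=V$ for some $t\ge 0$, and a failed zero forcing set (FZFS) otherwise. The failed zero forcing number $F(D)$ is the largest cardinality of an FZFS of $D$. -}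

module Defs where

open import Data.Bool.Properties using () renaming (_≟_ to _≟ᵇ_)
open import Data.Fin.Base using (Fin; zero)
open import Data.Fin.Permutation using (Permutation; _⟨$⟩ʳ_)
open import Data.Fin.Properties using (any?)
open import Data.Fin.Subset using (Subset; ⊤; ⁅_⁆; _∪_; _─_; ∣_∣)
open import Data.Fin.Subset.Properties using (_∈?_)
open import Data.Nat.Base using (ℕ; zero; suc; _≤_; NonZero)
open import Data.Product.Base using (∃-syntax; _×_; _,_)
open import Data.Sum.Base as Sum using (_⊎_; [_,_])
open import Data.Vec.Base using (tabulate)
open import Data.Vec.Properties using (≡-dec)
open import Function.Bundles using (_⇔_)
open import Level using (0ℓ)
open import Relation.Binary.Core using (Rel)
open import Relation.Binary.Definitions using (Decidable; DecidableEquality)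
open import Relation.Binary.PropositionalEquality using (_≡_; _≢_)
open import Relation.Nullary using (¬_; does; _×-dec_)

-- Finite simple digraphs with vertex set Fin n.  Decidability of Arc makes
-- the arc set an honest finite set, so neighbourhoods are `Subset`s.
record Digraph (n : ℕ) : Set₁ where
  field
    nonEmpty : NonZero n
    Arc      : Rel (Fin n) 0ℓ
    arc?     : Decidable Arc
    loopless : ∀ {v} → ¬ Arc v v

record Graph (n : ℕ) : Set₁ where
  field
    Adj       : Rel (Fin n) 0ℓ
    symmetric : ∀ {u v} → Adj u v → Adj v u
    loopless  : ∀ {v} → ¬ Adj v v

record _≅_ {m n : ℕ} (G : Graph m) (H : Graph n) : Set where
  field
    bijection : Permutation m n
    adj⇔adj   : ∀ u v → Graph.Adj G u v ⇔
                        Graph.Adj H (bijection ⟨$⟩ʳ u) (bijection ⟨$⟩ʳ v)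

infix 4 _≅_

UG : ∀ {n} → Digraph n → Graph n
UG D = record
  { Adj       = λ u v → Arc u v ⊎ Arc v u
  ; symmetric = Sum.swap
  ; loopless  = [ loopless , loopless ]
  }
  where open Digraph D

-- The star K_{1,t}; its centre is the vertex zero.
K₁,_ : (t : ℕ) → Graph (suc t)
K₁, t = record
  { Adj       = λ u v → (u ≡ zero × v ≢ zero) ⊎ (v ≡ zero × u ≢ zero)
  ; symmetric = Sum.swap
  ; loopless  = [ (λ (p , q) → q p) , (λ (p , q) → q p) ]
  }

infix 5 K₁,_

_≟ˢ_ : ∀ {n} → DecidableEquality (Subset n)
_≟ˢ_ = ≡-dec _≟ᵇ_

module _ {n : ℕ} (D : Digraph n) where
  open Digraph D

  N⁺ : Fin n → Subset n
  N⁺ v = tabulate λ u → does (arc? v u)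

  N⁻ : Fin n → Subset n
  N⁻ v = tabulate λ u → does (arc? u v)

  inDegree : Fin n → ℕ
  inDegree v = ∣ N⁻ v ∣

  Oriented : Set
  Oriented = ∀ u v → Arc u v → ¬ Arc v u

  Leaf : Fin n → Set
  Leaf v = ∣ N⁺ v ∪ N⁻ v ∣ ≡ 1

  -- { w : {w} = N⁺(v) \ S for some v ∈ S }
  forced : Subset n → Subset n
  forced S = tabulate λ w →
    does (any? λ v → (v ∈? S) ×-dec (⁅ w ⁆ ≟ˢ (N⁺ v ─ S)))

  B : ℕ → Subset n → Subset n
  B zero    S = S
  B (suc i) S = B i S ∪ forced (B i S)

  ZFS : Subset n → Set
  ZFS S = ∃[ i ] B i S ≡ ⊤

  FZFS : Subset n → Set
  FZFS S = ¬ ZFS S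

  -- IsF k says that F(D) = k, i.e. that k is the maximum of ∣ S ∣ over all
  -- FZFSs S; at most one k satisfies it.
  IsF : ℕ → Set
  IsF k = (∃[ S ] FZFS S × ∣ S ∣ ≡ k) × (∀ S → FZFS S → ∣ S ∣ ≤ k)

{-# OPTIONS --safe #-}

-- Call a nonempty vertex set a fort if no vertex outside it has exactly one
-- out-neighbour in it; the complement of a fort is a failed zero forcing set.
-- A vertex of in-degree 0 is a fort on its own, and two leaves with a common
-- in-neighbour form a fort (as do the two vertices of K_{1,1}), which gives
-- the lower bounds t and t − 1.  Conversely, an FZFS misses some vertex, and
-- at least two if every vertex has an in-neighbour v, since v forces a single
-- missing one.  Finally, a star has a vertex of in-degree 0 exactly when it
-- is oriented or one of its leaves has in-degree 0.
module Submission where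

open import Defs
open import Data.Fin.Base using (Fin; zero; suc; punchIn)
open import Data.Fin.Permutation using (_⟨$⟩ʳ_; _⟨$⟩ˡ_; inverseˡ; inverseʳ; ↔⇒≡)
open import Data.Fin.Properties using (any?; _≟_; punchIn-injective; punchInᵢ≢i)
open import Data.Fin.Subset
open import Data.Fin.Subset.Properties
open import Data.Nat.Base using (ℕ; zero; suc; _≤_; _<_; _∸_; _≥_; s≤s)
open import Data.Nat.Properties
  using (n≮0; ∸-monoˡ-≤; ≤-trans)
open import Data.Product.Base using (∃-syntax; _×_; _,_; proj₁; proj₂)
open import Data.Sum.Base as Sum using (_⊎_; inj₁; inj₂)
open import Data.Vec.Base using (tabulate; _∷_; here; there)
open import Data.Vec.Properties using (lookup∘tabulate; lookup⇒[]=; []=⇒lookup)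
open import Function.Base using (_∘_)
open import Function.Bundles using (_⇔_; mk⇔; Equivalence)
open import Level using (Level)
open import Relation.Binary.PropositionalEquality
  using (_≡_; _≢_; refl; sym; trans; cong; subst; ≢-sym)
open import Relation.Nullary
  using (¬_; does; yes; no; contradiction; ¬?; _×-dec_)
open import Relation.Nullary.Decidable using (dec-true; decidable-stable)
open import Relation.Unary using (Pred; Decidable)

open Equivalence using (to; from)

private variable
  ℓ : Level
  n t : ℕ

-- Membership and cardinality of finite subsets.

module _ {P : Pred (Fin n) ℓ} (P? : Decidable P) {x : Fin n} where

  ∈-tabulate⁺ : P x → x ∈ tabulate (does ∘ P?)
  ∈-tabulate⁺ px =
    lookup⇒[]= x _ (trans (lookup∘tabulate (does ∘ P?) x) (dec-true (P? x) px))

  ∈-tabulate⁻ : x ∈ tabulate (does ∘ P?) → P x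
  ∈-tabulate⁻ x∈
    with P? x | trans (sym (lookup∘tabulate (does ∘ P?) x)) ([]=⇒lookup x∈)
  ... | yes px | _  = px
  ... | no  _  | ()

x∈p─q⇒x∉q : ∀ (p q : Subset n) {x} → x ∈ p ─ q → x ∉ q
x∈p─q⇒x∉q (_ ∷ p) (inside  ∷ q) (there x∈) (there x∈q) = x∈p─q⇒x∉q p q x∈ x∈q
x∈p─q⇒x∉q (_ ∷ p) (outside ∷ q) (there x∈) (there x∈q) = x∈p─q⇒x∉q p q x∈ x∈q

∣p∣≡0⇒Empty : {p : Subset n} → ∣ p ∣ ≡ 0 → Empty p
∣p∣≡0⇒Empty {p = p} ∣p∣≡0 (x , x∈p) =
  n≮0 (subst (∣ p - x ∣ <_) ∣p∣≡0 (x∈p⇒∣p-x∣<∣p∣ x∈p))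

Empty⇒∣p∣≡0 : {p : Subset n} → Empty p → ∣ p ∣ ≡ 0
Empty⇒∣p∣≡0 {n} p-empty = trans (cong ∣_∣ (Empty-unique p-empty)) (∣⊥∣≡0 n)

∣⁅x,y⁆∣≡2 : {x y : Fin n} → x ≢ y → ∣ ⁅ x ⁆ ∪ ⁅ y ⁆ ∣ ≡ 2
∣⁅x,y⁆∣≡2 {x = zero}  {zero}  x≢y = contradiction refl x≢y
∣⁅x,y⁆∣≡2 {x = zero}  {suc y} _   =
  cong suc (trans (cong ∣_∣ (∪-identityˡ ⁅ y ⁆)) (∣⁅x⁆∣≡1 y))
∣⁅x,y⁆∣≡2 {x = suc x} {zero}  _   =
  cong suc (trans (cong ∣_∣ (∪-identityʳ ⁅ x ⁆)) (∣⁅x⁆∣≡1 x))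
∣⁅x,y⁆∣≡2 {x = suc x} {suc y} x≢y = ∣⁅x,y⁆∣≡2 (x≢y ∘ cong suc)

p≢⊤⇒∃∉ : {p : Subset n} → p ≢ ⊤ → ∃[ x ] x ∉ p
p≢⊤⇒∃∉ {p = p} p≢⊤ with nonempty? (∁ p)
... | yes (x , x∈∁p) = x , x∈∁p⇒x∉p x∈∁p
... | no  ∁p-empty   =
  contradiction (⊆-antisym ⊆⊤ λ _ → x∉∁p⇒x∈p λ x∈∁p → ∁p-empty (_ , x∈∁p)) p≢⊤

x∉p⇒∣p∣<n : {p : Subset n} {x : Fin n} → x ∉ p → ∣ p ∣ < n
x∉p⇒∣p∣<n {n} {p} {x} x∉p =
  subst (∣ p ∣ <_) (∣⊤∣≡n n) (p⊂q⇒∣p∣<∣q∣ (⊆⊤ , x , ∈⊤ , x∉p))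

-- Adding `x` to `p` and then passing to the full set are two strict inclusions.
x,y∉p⇒∣p∣≤n∸2 : {p : Subset n} {x y : Fin n} →
                x ≢ y → x ∉ p → y ∉ p → ∣ p ∣ ≤ n ∸ 2
x,y∉p⇒∣p∣≤n∸2 {n} {p} {x} {y} x≢y x∉p y∉p = ∸-monoˡ-≤ 2 (≤-trans
  (s≤s (p⊂q⇒∣p∣<∣q∣ (p⊆p∪q ⁅ x ⁆ , x , q⊆p∪q p ⁅ x ⁆ (x∈⁅x⁆ x) , x∉p)))
  (x∉p⇒∣p∣<n y∉p∪⁅x⁆))
  where
  y∉p∪⁅x⁆ : y ∉ p ∪ ⁅ x ⁆
  y∉p∪⁅x⁆ y∈ with x∈p∪q⁻ p ⁅ x ⁆ y∈
  ... | inj₁ y∈p   = y∉p y∈p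
  ... | inj₂ y∈⁅x⁆ = x≢y (sym (x∈⁅y⁆⇒x≡y x y∈⁅x⁆))

-- Forts and failed zero forcing sets.

module _ (D : Digraph n) where
  open Digraph D

  -- "Not exactly one out-neighbour in `p`" is phrased without counting: every such out-neighbour
  -- comes with a second one.
  Fort : Subset n → Set
  Fort p = Nonempty p ×
    (∀ {v w} → v ∉ p → w ∈ p → Arc v w → ∃[ u ] u ≢ w × u ∈ p × Arc v u)

  Source : Fin n → Set
  Source w = ∀ {v} → ¬ Arc v w

  module _ {S : Subset n} where

    ∈-forced⁺ : ∀ {v w} → v ∈ S → ⁅ w ⁆ ≡ N⁺ D v ─ S → w ∈ forced D S
    ∈-forced⁺ v∈S eq = ∈-tabulate⁺
      (λ w → any? λ v → (v ∈? S) ×-dec (⁅ w ⁆ ≟ˢ (N⁺ D v ─ S))) (_ , v∈S , eq)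

    ∈-forced⁻ : ∀ {w} → w ∈ forced D S → ∃[ v ] v ∈ S × ⁅ w ⁆ ≡ N⁺ D v ─ S
    ∈-forced⁻ = ∈-tabulate⁻
      (λ w → any? λ v → (v ∈? S) ×-dec (⁅ w ⁆ ≟ˢ (N⁺ D v ─ S)))

  -- Induction on `i`: if `v` forces `x`, then `x` is its only out-neighbour outside the current
  -- set; but `v` lies outside the fort, so it has a second out-neighbour in the fort, which is
  -- still uncoloured by induction.
  fort-avoids-B : ∀ {p} → Fort p → ∀ i {x} → x ∈ p → x ∉ B D i (∁ p)
  fort-avoids-B fort zero x∈p x∈∁p = x∈∁p⇒x∉p x∈∁p x∈p
  fort-avoids-B {p} fort (suc i) {x} x∈p x∈ with x∈p∪q⁻ (B D i (∁ p)) _ x∈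
  ... | inj₁ x∈B = fort-avoids-B fort i x∈p x∈B
  ... | inj₂ x∈forced
    with v , v∈B , ⁅x⁆≡ ← ∈-forced⁻ x∈forced
    with x∈N⁺ ← p─q⊆p (N⁺ D v) _ (subst (x ∈_) ⁅x⁆≡ (x∈⁅x⁆ x))
    with u , u≢x , u∈p , v→u ← proj₂ fort
           (λ v∈p → fort-avoids-B fort i v∈p v∈B) x∈p (∈-tabulate⁻ (arc? v) x∈N⁺)
    = u≢x (x∈⁅y⁆⇒x≡y x (subst (u ∈_) (sym ⁅x⁆≡)
        (x∈p∧x∉q⇒x∈p─q (∈-tabulate⁺ (arc? v) v→u) (fort-avoids-B fort i u∈p))))

  fort⇒FZFS : ∀ {p} → Fort p → FZFS D (∁ p)
  fort⇒FZFS fort@((_ , x∈p) , _) (i , B≡⊤) =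
    fort-avoids-B fort i x∈p (subst (_ ∈_) (sym B≡⊤) ∈⊤)

  source⇒fort : ∀ {w} → Source w → Fort ⁅ w ⁆
  source⇒fort {w} source = (w , x∈⁅x⁆ w) , λ {v} _ x∈ v→x →
    contradiction (subst (Arc v) (x∈⁅y⁆⇒x≡y w x∈) v→x) source

  -- Only arcs from third vertices are compared, so `a` and `b` may be adjacent to each other; the
  -- two vertices of K_{1,1} need this.
  twins⇒fort : ∀ {a b} → a ≢ b →
               (∀ {v} → v ≢ a → v ≢ b → Arc v a ⇔ Arc v b) → Fort (⁅ a ⁆ ∪ ⁅ b ⁆)
  twins⇒fort {a} {b} a≢b twins = (a , a∈) , exits
    where
    a∈ : a ∈ ⁅ a ⁆ ∪ ⁅ b ⁆
    a∈ = p⊆p∪q ⁅ b ⁆ (x∈⁅x⁆ a)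

    b∈ : b ∈ ⁅ a ⁆ ∪ ⁅ b ⁆
    b∈ = q⊆p∪q ⁅ a ⁆ ⁅ b ⁆ (x∈⁅x⁆ b)

    exits : ∀ {v w} → v ∉ ⁅ a ⁆ ∪ ⁅ b ⁆ → w ∈ ⁅ a ⁆ ∪ ⁅ b ⁆ → Arc v w →
            ∃[ u ] u ≢ w × u ∈ ⁅ a ⁆ ∪ ⁅ b ⁆ × Arc v u
    exits v∉ w∈ v→w
      with v⇔ ← twins (λ { refl → v∉ a∈ }) (λ { refl → v∉ b∈ })
      with x∈p∪q⁻ ⁅ a ⁆ ⁅ b ⁆ w∈
    ... | inj₁ w∈⁅a⁆ with refl ← x∈⁅y⁆⇒x≡y a w∈⁅a⁆ = b , ≢-sym a≢b , b∈ , to v⇔ v→w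
    ... | inj₂ w∈⁅b⁆ with refl ← x∈⁅y⁆⇒x≡y b w∈⁅b⁆ = a , a≢b , a∈ , from v⇔ v→w

  FZFS⇒∃∉ : ∀ {S} → FZFS D S → ∃[ x ] x ∉ S
  FZFS⇒∃∉ fzfs = p≢⊤⇒∃∉ λ S≡⊤ → fzfs (0 , S≡⊤)

  -- Since there are no loops, `v` differs from `a` and so lies in `S`; its only out-neighbour
  -- outside `S` is `a`, and one step finishes.
  sole-missing-forced : ∀ {S a v} → a ∉ S → (∀ {b} → b ≢ a → b ∈ S) → Arc v a → ZFS D S
  sole-missing-forced {S} {a} {v} a∉S rest v→a = 1 , ⊆-antisym ⊆⊤ λ {x} _ → all∈ x
    where
    v∈S : v ∈ S
    v∈S = rest λ { refl → loopless v→a }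

    ⁅a⁆⊆ : ⁅ a ⁆ ⊆ N⁺ D v ─ S
    ⁅a⁆⊆ x∈ with refl ← x∈⁅y⁆⇒x≡y a x∈ =
      x∈p∧x∉q⇒x∈p─q (∈-tabulate⁺ (arc? v) v→a) a∉S

    ⊆⁅a⁆ : N⁺ D v ─ S ⊆ ⁅ a ⁆
    ⊆⁅a⁆ {x} x∈ with x ≟ a
    ... | yes refl = x∈⁅x⁆ a
    ... | no  x≢a  = contradiction (rest x≢a) (x∈p─q⇒x∉q (N⁺ D v) S x∈)

    all∈ : ∀ x → x ∈ B D 1 S
    all∈ x with x ≟ a
    ... | yes refl = q⊆p∪q S _ (∈-forced⁺ v∈S (⊆-antisym ⁅a⁆⊆ ⊆⁅a⁆))
    ... | no  x≢a  = p⊆p∪q _ (rest x≢a)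

  FZFS⇒∣S∣≤n∸2 : (∀ w → ∃[ v ] Arc v w) → ∀ {S} → FZFS D S → ∣ S ∣ ≤ n ∸ 2
  FZFS⇒∣S∣≤n∸2 in-nbr {S} fzfs with a , a∉S ← FZFS⇒∃∉ fzfs
    with any? (λ b → ¬? (b ≟ a) ×-dec ¬? (b ∈? S))
  ... | yes (b , b≢a , b∉S) = x,y∉p⇒∣p∣≤n∸2 b≢a b∉S a∉S
  ... | no  none = contradiction
    (sole-missing-forced a∉S
      (λ {b} b≢a → decidable-stable (b ∈? S) λ b∉S → none (b , b≢a , b∉S))
      (proj₂ (in-nbr a)))
    fzfs

  inDegree≡0⇒source : ∀ {w} → inDegree D w ≡ 0 → Source w
  inDegree≡0⇒source {w} deg≡0 v→w =
    ∣p∣≡0⇒Empty deg≡0 (_ , ∈-tabulate⁺ (λ u → arc? u w) v→w)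

  source⇒inDegree≡0 : ∀ {w} → Source w → inDegree D w ≡ 0
  source⇒inDegree≡0 {w} source =
    Empty⇒∣p∣≡0 λ (_ , v∈) → source (∈-tabulate⁻ (λ u → arc? u w) v∈)

  -- Digraphs whose underlying graph is a star.

  -- The adjacency of the star read on the vertices of `D` itself, so that the isomorphism is
  -- unfolded only once.
  IsCentre : Fin n → Set
  IsCentre c = ∀ u v →
    Graph.Adj (UG D) u v ⇔ ((u ≡ c × v ≢ c) ⊎ (v ≡ c × u ≢ c))

  ≅K₁⇒centre : UG D ≅ K₁, t → ∃[ c ] IsCentre c
  ≅K₁⇒centre iso = π ⟨$⟩ˡ zero , λ u v → mk⇔
    (Sum.map pull pull ∘ to (adj⇔adj u v))
    (from (adj⇔adj u v) ∘ Sum.map push push)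
    where
    open _≅_ iso renaming (bijection to π)

    pull-≡ : ∀ {u} → π ⟨$⟩ʳ u ≡ zero → u ≡ π ⟨$⟩ˡ zero
    pull-≡ eq = trans (sym (inverseˡ π)) (cong (π ⟨$⟩ˡ_) eq)

    push-≡ : ∀ {u} → u ≡ π ⟨$⟩ˡ zero → π ⟨$⟩ʳ u ≡ zero
    push-≡ eq = trans (cong (π ⟨$⟩ʳ_) eq) (inverseʳ π)

    pull : ∀ {u v} → π ⟨$⟩ʳ u ≡ zero × π ⟨$⟩ʳ v ≢ zero →
           u ≡ π ⟨$⟩ˡ zero × v ≢ π ⟨$⟩ˡ zero
    pull (eq , neq) = pull-≡ eq , neq ∘ push-≡

    push : ∀ {u v} → u ≡ π ⟨$⟩ˡ zero × v ≢ π ⟨$⟩ˡ zero →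
           π ⟨$⟩ʳ u ≡ zero × π ⟨$⟩ʳ v ≢ zero
    push (eq , neq) = push-≡ eq , neq ∘ pull-≡

  module Star {c : Fin n} (centre : IsCentre c) where

    nbr-of-noncentre : ∀ {u v} → v ≢ c → Graph.Adj (UG D) u v → u ≡ c
    nbr-of-noncentre {u} {v} v≢c adj with to (centre u v) adj
    ... | inj₁ (u≡c , _) = u≡c
    ... | inj₂ (v≡c , _) = contradiction v≡c v≢c

    noncentre⇒leaf : ∀ {v} → v ≢ c → Leaf D v
    noncentre⇒leaf {v} v≢c = trans (cong ∣_∣ (⊆-antisym nbrs⊆ ⊆nbrs)) (∣⁅x⁆∣≡1 c)
      where
      nbrs⊆ : N⁺ D v ∪ N⁻ D v ⊆ ⁅ c ⁆
      nbrs⊆ u∈ = from x∈⁅y⁆⇔x≡y (nbr-of-noncentre v≢c (Sum.swap (Sum.map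
        (∈-tabulate⁻ (arc? v)) (∈-tabulate⁻ (λ u → arc? u v)) (x∈p∪q⁻ (N⁺ D v) _ u∈))))

      ⊆nbrs : ⁅ c ⁆ ⊆ N⁺ D v ∪ N⁻ D v
      ⊆nbrs u∈ with refl ← x∈⁅y⁆⇒x≡y c u∈ = x∈p∪q⁺ (Sum.map
        (∈-tabulate⁺ (arc? v)) (∈-tabulate⁺ (λ u → arc? u v))
        (from (centre v c) (inj₂ (refl , v≢c))))

    -- If the centre is not a source, some `v` has an arc to it. The only possible in-neighbour of
    -- `v` is the centre, and orientation forbids that arc.
    oriented⇒∃source : Oriented D → ∃[ w ] Source w
    oriented⇒∃source oriented with any? (λ v → arc? v c)
    ... | no  none      = c , λ v→c → none (_ , v→c)
    ... | yes (v , v→c) = v , λ {u} u→v → oriented v c v→c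
      (subst (λ x → Arc x v) (nbr-of-noncentre v≢c (inj₁ u→v)) u→v)
      where
      v≢c : v ≢ c
      v≢c refl = loopless v→c

    -- Every arc has the centre as an endpoint, so one of two opposite arcs would enter it.
    centre-source⇒oriented : Source c → Oriented D
    centre-source⇒oriented source u v u→v v→u with to (centre u v) (inj₁ u→v)
    ... | inj₁ (refl , _) = source v→u
    ... | inj₂ (refl , _) = source u→v

    module _ (¬special : ¬ (Oriented D ⊎ (∃[ v ] Leaf D v × inDegree D v ≡ 0))) where

      -- Otherwise `v`, which can be entered only from the centre, would be a leaf of in-degree 0.
      centre→noncentre : ∀ {v} → v ≢ c → Arc c v
      centre→noncentre {v} v≢c = decidable-stable (arc? c v) λ c↛v →
        ¬special (inj₂ (v , noncentre⇒leaf v≢c , source⇒inDegree≡0 λ u→v →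
          c↛v (subst (λ x → Arc x v) (nbr-of-noncentre v≢c (inj₁ u→v)) u→v)))

      in-neighbour : ∀ w → ∃[ v ] Arc v w
      in-neighbour w with w ≟ c
      ... | no  w≢c  = c , centre→noncentre w≢c
      ... | yes refl = decidable-stable (any? λ v → arc? v c) λ none →
        ¬special (inj₁ (centre-source⇒oriented λ v→c → none (_ , v→c)))

      -- Each noncentre has the centre as its one and only in-neighbour.
      noncentres-twins : ∀ {a b} → a ≢ c → b ≢ c → ∀ {v} → Arc v a ⇔ Arc v b
      noncentres-twins a≢c b≢c = mk⇔ (shift a≢c b≢c) (shift b≢c a≢c)
        where
        shift : ∀ {a b v} → a ≢ c → b ≢ c → Arc v a → Arc v b
        shift a≢c b≢c v→a with refl ← nbr-of-noncentre a≢c (inj₁ v→a) =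
          centre→noncentre b≢c

-- The two values of F.

source⇒IsF : (D : Digraph (suc t)) → (∃[ w ] Source D w) → IsF D t
source⇒IsF {t} D (w , source) =
  (∁ ⁅ w ⁆ , fort⇒FZFS D (source⇒fort D source) ,
    trans (∣∁p∣≡n∸∣p∣ ⁅ w ⁆) (cong (suc t ∸_) (∣⁅x⁆∣≡1 w))) ,
  λ S fzfs → ∸-monoˡ-≤ 1 (x∉p⇒∣p∣<n (proj₂ (FZFS⇒∃∉ D fzfs)))

twins⇒IsF : (D : Digraph n) → let open Digraph D in ∀ {a b} → a ≢ b →
            (∀ {v} → v ≢ a → v ≢ b → Arc v a ⇔ Arc v b) →
            (∀ w → ∃[ v ] Arc v w) → IsF D (n ∸ 2)
twins⇒IsF {n} D {a} {b} a≢b twins in-nbr =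
  (∁ (⁅ a ⁆ ∪ ⁅ b ⁆) , fort⇒FZFS D (twins⇒fort D a≢b twins) ,
    trans (∣∁p∣≡n∸∣p∣ (⁅ a ⁆ ∪ ⁅ b ⁆)) (cong (n ∸_) (∣⁅x,y⁆∣≡2 a≢b))) ,
  λ S → FZFS⇒∣S∣≤n∸2 D in-nbr

star-IsF : (D : Digraph (suc t)) → t ≥ 1 → ∀ {c} → IsCentre D c →
  ¬ (Oriented D ⊎ (∃[ v ] Leaf D v × inDegree D v ≡ 0)) → IsF D (t ∸ 1)
-- There is a single noncentre here, so both vertices serve as twins; no third vertex exists and the
-- twin condition is vacuous.
star-IsF {suc zero} D _ centre ¬special =
  twins⇒IsF D {zero} {suc zero} (λ ())
    (λ { {zero} v≢0 _ → contradiction refl v≢0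
       ; {suc zero} _ v≢1 → contradiction refl v≢1 })
    (Star.in-neighbour D centre ¬special)
-- `punchIn c` enumerates the vertices other than `c`; its first two values are distinct leaves.
star-IsF {suc (suc _)} D _ {c} centre ¬special =
  twins⇒IsF D {punchIn c zero} {punchIn c (suc zero)}
    (λ eq → contradiction (punchIn-injective c _ _ eq) λ ())
    (λ _ _ → Star.noncentres-twins D centre ¬special
      (punchInᵢ≢i c zero) (punchInᵢ≢i c (suc zero)))
    (Star.in-neighbour D centre ¬special)

theorem4p4 : ∀ {n} (D : Digraph n) (t : ℕ) → t ≥ 1 → UG D ≅ K₁, t →
    (Oriented D ⊎ (∃[ v ] Leaf D v × inDegree D v ≡ 0) → IsF D t) ×
    (¬ (Oriented D ⊎ (∃[ v ] Leaf D v × inDegree D v ≡ 0)) → IsF D (t ∸ 1))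
-- The bijection of vertex sets identifies `n` with `suc t`.
theorem4p4 D t t≥1 iso with refl ← ↔⇒≡ (_≅_.bijection iso)
  with c , centre ← ≅K₁⇒centre D iso =
  (λ special → source⇒IsF D (∃source special)) , star-IsF D t≥1 centre
  where
  ∃source : Oriented D ⊎ (∃[ v ] Leaf D v × inDegree D v ≡ 0) → ∃[ w ] Source D w
  ∃source (inj₁ oriented)         = Star.oriented⇒∃source D centre oriented
  ∃source (inj₂ (v , _ , deg≡0)) = v , inDegree≡0⇒source D deg≡0
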